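{- Let $n\ge 1$ and let $(f_{ij})_{0\le j\le i\le n-1}$ be the $f$-triangle of $\Delta_{\mathrm{Dyck}_n}$. Then \[ f_{ij}=\Big|\bigl\{\,w\in\mathrm{Dyck}_n : |V(w)|=j\text{ and }\mu(w)=i\,\bigr\}\Big|,\qquad 0\le j\le i\le n-1 . \]
   Context: A Dyck path of semilength $n$ is a word $w=w_1\cdots w_{2n}$ in $\{U,D\}$ with equally many $U$'s and $D$'s such that every prefix contains at least as many $U$'s as $D$'s; $\mathrm{Dyck}_n$ is the set of these. A valley of $w$ is an index $i$ with $w_i=D$, $w_{i+1}=U$, identified with its position $(i,y)$, where $y$ is the number of $U$'s minus the number of $D$'s in $w_1\cdots w_i$. $V(w)$ is the set of valley positions of $w$, and $\Delta_{\mathrm{Dyck}_n}=\{V(w):w\in\mathrm{Dyck}_n\}$, which is a simplicial complex of dimension $n-2$. For $w\in\mathrm{Dyck}_n$ with valleys $p_1,\ldots,p_\ell$ listed from left to right, let $p_0=(0,0)$ be the starting point and $p_{\ell+1}=(2n,0)$ the terminal point of $w$. For $1\le i\le\ell+1$ let $u_i$ and $d_i$ be the numbers of $U$-steps and $D$-steps in the portion of $w$ from $p_{i-1}$ to $p_i$. Define $\mu(w)=\Bigl(\sum_{i=1}^{\ell+1}\min\{u_i,d_i\}\Bigr)-1$. For a simplicial complex $\Delta$, the degree of a face $\sigma$ is $\deg(\sigma)=\max\{|\tau| : \tau\in\Delta,\ \sigma\subseteq\tau\}$. The $f$-triangle of $\Delta$ is the array $(f_{ij})$ where $f_{ij}$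 is the number of faces $\sigma$ with $|\sigma|=j$ and $\deg(\sigma)=i$. -}

module Defs where

open import Data.Integer using (ℤ; _⊖_)
import Data.Integer.Properties as ℤ
open import Data.List
  using (List; []; _∷_; _∷ʳ_; length; map; filter; take; drop; head; inits;
         upTo; zipWith; cartesianProductWith; deduplicate)
open import Data.List.Extrema.Nat using (max)
open import Data.List.Membership.Propositional using (_∈_)
open import Data.List.Membership.Propositional.Properties
  using (∈-cartesianProductWith⁺; ∈-filter⁺; ∈-filter⁻)
open import Data.List.Properties using (∷-injective)
open import Data.List.Relation.Unary.All using (All; []; _∷_; all?)
open import Data.List.Relation.Unary.AllPairs using ([]; _∷_)
open import Data.List.Relation.Unary.Any using (here; there)
open import Data.List.Relation.Unary.Unique.Propositional using (Unique)
open import Data.List.Relation.Unary.Unique.Propositional.Properties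
  using (map⁺; filter⁺; upTo⁺; cartesianProductWith⁺)
import Data.List.Relation.Binary.Subset.Propositional as List
import Data.List.Relation.Binary.Subset.DecPropositional as DecSubset
open import Data.Maybe using (Maybe; just; nothing)
import Data.Maybe.Properties as Maybe
open import Data.Nat using (ℕ; zero; suc; _*_; _∸_; _≤_; _⊓_; _≟_; _≤?_)
open import Data.Nat.ListAction using (sum)
open import Data.Product using (_×_; _,_; proj₁; proj₂)
import Data.Product.Properties as Product
open import Function using (_∘_)
open import Relation.Binary using (Decidable; DecidableEquality)
open import Relation.Binary.PropositionalEquality using (_≡_; refl; cong; subst)
open import Relation.Nullary using (yes; no)
open import Relation.Nullary.Decidable using (_×-dec_)
import Relation.Unary as Unary

record FinSet (A : Set) : Set where
  constructor finSet
  field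
    elements : List A
    .unique  : Unique elements

open FinSet public

card : {A : Set} → FinSet A → ℕ
card σ = length (elements σ)

_⊆_ : {A : Set} → FinSet A → FinSet A → Set
σ ⊆ τ = elements σ List.⊆ elements τ

-- FinSets listing the same elements in a different order are the same set,
-- so equality of sets is ≐ rather than ≡.
_≐_ : {A : Set} → FinSet A → FinSet A → Set
σ ≐ τ = σ ⊆ τ × τ ⊆ σ

-- A finite simplicial complex is given by the list of its faces, with no face
-- repeated up to ≐.  Degree and f-triangle do not refer to closure under
-- subsets, so they are defined for any such list.
module Complex {A : Set} (_≟ᴬ_ : DecidableEquality A) where

  _⊆?_ : Decidable (_⊆_ {A})
  σ ⊆? τ = DecSubset._⊆?_ _≟ᴬ_ (elements σ) (elements τ)

  _≐?_ : Decidable (_≐_ {A})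
  σ ≐? τ = (σ ⊆? τ) ×-dec (τ ⊆? σ)

  -- For σ ∈ Δ the maximum is over a nonempty list, and the default 0 is
  -- immaterial.
  deg : List (FinSet A) → FinSet A → ℕ
  deg Δ σ = max 0 (map card (filter (σ ⊆?_) Δ))

  fTriangle : List (FinSet A) → ℕ → ℕ → ℕ
  fTriangle Δ i j =
    length (filter (λ σ → (card σ ≟ j) ×-dec (deg Δ σ ≟ i)) Δ)

data Step : Set where
  U D : Step

_≟ˢ_ : DecidableEquality Step
U ≟ˢ U = yes refl
U ≟ˢ D = no λ ()
D ≟ˢ U = no λ ()
D ≟ˢ D = yes refl

Word : Set
Word = List Step

#U #D : Word → ℕ
#U = length ∘ filter (U ≟ˢ_)
#D = length ∘ filter (D ≟ˢ_)

IsDyck : ℕ → Word → Set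
IsDyck n w = length w ≡ 2 * n × #U w ≡ #D w × All (λ p → #D p ≤ #U p) (inits w)

isDyck? : ∀ n → Unary.Decidable (IsDyck n)
isDyck? n w =
  (length w ≟ 2 * n) ×-dec (#U w ≟ #D w) ×-dec all? (λ p → #D p ≤? #U p) (inits w)

words : ℕ → List Word
words zero    = [] ∷ []
words (suc m) = cartesianProductWith _∷_ (U ∷ D ∷ []) (words m)

Dyck : ℕ → List Word
Dyck n = filter (isDyck? n) (words (2 * n))

∈-words : ∀ w → w ∈ words (length w)
∈-words []      = here refl
∈-words (s ∷ w) = ∈-cartesianProductWith⁺ _∷_ (s∈UD s) (∈-words w)
  where
  s∈UD : ∀ s → s ∈ U ∷ D ∷ []
  s∈UD U = here refl
  s∈UD D = there (here refl)

words-unique : ∀ m → Unique (words m)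
words-unique zero    = [] ∷ []
words-unique (suc m) =
  cartesianProductWith⁺ _∷_ ∷-injective (((λ ()) ∷ []) ∷ [] ∷ []) (words-unique m)

∈-Dyck⁺ : ∀ {n w} → IsDyck n w → w ∈ Dyck n
∈-Dyck⁺ {n} {w} d@(len , _) =
  ∈-filter⁺ (isDyck? n) (subst (λ m → w ∈ words m) len (∈-words w)) d

∈-Dyck⁻ : ∀ {n w} → w ∈ Dyck n → IsDyck n w
∈-Dyck⁻ {n} w∈ = proj₂ (∈-filter⁻ (isDyck? n) {xs = words (2 * n)} w∈)

Dyck-unique : ∀ n → Unique (Dyck n)
Dyck-unique n = filter⁺ (isDyck? n) (words-unique (2 * n))

-- 1-based: w ‼ i is the i-th letter of w, if there is one.
_‼_ : Word → ℕ → Maybe Step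
w ‼ zero  = nothing
w ‼ suc k = head (drop k w)

IsValley : Word → ℕ → Set
IsValley w i = w ‼ i ≡ just D × w ‼ suc i ≡ just U

isValley? : ∀ w → Unary.Decidable (IsValley w)
isValley? w i =
  Maybe.≡-dec _≟ˢ_ (w ‼ i) (just D) ×-dec Maybe.≡-dec _≟ˢ_ (w ‼ suc i) (just U)

-- Increasing, i.e. from left to right; a valley i satisfies 1 ≤ i < length w.
valleys : Word → List ℕ
valleys w = filter (isValley? w) (upTo (length w))

Position : Set
Position = ℕ × ℤ

_≟ᴾ_ : DecidableEquality Position
_≟ᴾ_ = Product.≡-dec _≟_ ℤ._≟_

-- m ⊖ n is the integer difference of the naturals m and n.
position : Word → ℕ → Position
position w i = i , #U (take i w) ⊖ #D (take i w)

V : Word → FinSet Position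
V w = finSet (map (position w) (valleys w))
             (map⁺ (cong proj₁) (filter⁺ (isValley? w) (upTo⁺ (length w))))

open Complex _≟ᴾ_ public

ΔDyck : ℕ → List (FinSet Position)
ΔDyck n = deduplicate _≐?_ (map V (Dyck n))

-- The letters w_{a+1} ⋯ w_b.
portion : Word → ℕ → ℕ → Word
portion w a b = take (b ∸ a) (drop a w)

-- The zip runs over the pairs (p_{i-1}, p_i) for 1 ≤ i ≤ ℓ+1, each point given
-- by its first coordinate.  For semilength n ≥ 1 the sum is positive, so the
-- truncated subtraction is exact.
μ : Word → ℕ
μ w = sum (zipWith peak (0 ∷ valleys w) (valleys w ∷ʳ length w)) ∸ 1
  where
  peak : ℕ → ℕ → ℕ
  peak a b = #U (portion w a b) ⊓ #D (portion w a b)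

module Submission where

-- The bijection is the identity: V is injective on Dyck paths, and the degree of
-- the face V(w) is μ(w).  Injectivity: where two words first differ, one has D and
-- the other U; the former has a valley before its next U, and the latter is too
-- high to pass through it.  Degree: a path through the valleys of w crosses each
-- portion of w, with u ups and d downs, starting with U and ending with D, so it
-- has at most min{u,d} − 1 valleys inside; this is attained, for all portions at
-- once, by replacing U^u D^d with a zigzag of UDs followed by a single peak.

open import Defs
open import Data.Empty using (⊥-elim)
open import Data.Integer using (_⊖_)
import Data.Integer.Properties as ℤ
open import Data.List
  using (List; []; _∷_; _++_; _∷ʳ_; length; map; filter; take; drop; inits; upTo;
         applyUpTo; zipWith; replicate; concatMap; deduplicate)
open import Data.List.Extrema.Nat using (max; max≤v⁺; v≤max⁺)
open import Data.List.Membership.Propositional using (_∈_)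
open import Data.List.Membership.Propositional.Properties
  using (∈-map⁺; ∈-map⁻; ∈-filter⁺; ∈-filter⁻; ∈-upTo⁺)
open import Data.List.Properties
  using (filter-++; filter-all; length-++; length-map; map-∘; map-++; map-upTo;
         take-all; zipWith-cong; zipWith-map; ++-identityʳ)
open import Data.List.Relation.Unary.All as All using (All; []; _∷_)
import Data.List.Relation.Unary.All.Properties as All
open import Data.List.Relation.Unary.AllPairs using (AllPairs; []; _∷_)
import Data.List.Relation.Unary.Any as Any
open import Data.Nat
  using (ℕ; zero; suc; _+_; _∸_; _⊓_; _≤_; _<_; z≤n; s≤s; _≟_)
open import Data.Nat.ListAction using (sum)
open import Data.Nat.Properties
open import Data.Product using (_×_; _,_; ∃; ∃₂)
open import Data.Product.Properties using (,-injective)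
open import Data.Sum using (_⊎_; inj₁; inj₂)
open import Function using (_∘_)
open import Relation.Binary using (tri<; tri≈; tri>)
import Relation.Binary as Binary
open import Relation.Binary.PropositionalEquality
open import Relation.Nullary using (¬_; yes; no; contradiction)
open import Relation.Nullary.Decidable using (_×-dec_)
import Relation.Unary as Unary

-- Lists, integer differences and letter counts.

filter-map : ∀ {A B : Set} {P : B → Set} (P? : Unary.Decidable P) (f : A → B) xs →
  filter P? (map f xs) ≡ map f (filter (P? ∘ f) xs)
filter-map P? f [] = refl
filter-map P? f (x ∷ xs) with P? (f x)
... | yes _ = cong (f x ∷_) (filter-map P? f xs)
... | no  _ = filter-map P? f xs

-- Sharing one `R?` makes the two predicates coincide once `f x` and `g x` are identified. This lets
-- `deg` be exchanged for `μ` inside a filter, given agreement on the listed words alone.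
filter-cong-All : ∀ {A B : Set} {R : A → B → Set} {f g : A → B}
  (R? : Binary.Decidable {A = A} {B = B} R) {xs} →
  All (λ x → f x ≡ g x) xs →
  filter (λ x → R? x (f x)) xs ≡ filter (λ x → R? x (g x)) xs
filter-cong-All R? [] = refl
filter-cong-All {f = f} {g} R? {x ∷ xs} (eq ∷ eqs) with ih ← filter-cong-All R? eqs | f x | g x | eq
... | y | _ | refl with R? x y
...   | yes _ = cong (x ∷_) ih
...   | no  _ = ih

deduplicate-AllPairs : ∀ {A : Set} {R : A → A → Set} (R? : Binary.Decidable R) {xs} →
  AllPairs (λ x y → ¬ R x y) xs → deduplicate R? xs ≡ xs
deduplicate-AllPairs R? [] = refl
deduplicate-AllPairs R? {x ∷ xs} (¬Rx ∷ ¬R)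
  rewrite deduplicate-AllPairs R? ¬R = cong (x ∷_) (filter-all _ ¬Rx)

-- If `a < c`, equal sums force `d < b`, and then `a ⊖ b` is strictly below `c ⊖ d`. Hence the
-- position of a valley determines how many U's and D's precede it.
⊖-+-injective : ∀ {a b c d} → a + b ≡ c + d → a ⊖ b ≡ c ⊖ d → a ≡ c × b ≡ d
⊖-+-injective {a} {b} {c} {d} sum≡ diff≡ with <-cmp a c
... | tri≈ _ refl _ = refl , +-cancelˡ-≡ a b d sum≡
... | tri< a<c _ _ = contradiction diff≡ (ℤ.<⇒≢ (ℤ.<-trans (ℤ.⊖-monoˡ-< b a<c) (ℤ.⊖-monoʳ->-< c
        (≰⇒> λ b≤d → <-irrefl sum≡ (+-mono-<-≤ a<c b≤d)))))
... | tri> _ _ c<a = contradiction (sym diff≡) (ℤ.<⇒≢ (ℤ.<-trans (ℤ.⊖-monoˡ-< d c<a) (ℤ.⊖-monoʳ->-< a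
        (≰⇒> λ d≤b → <-irrefl (sym sum≡) (+-mono-<-≤ c<a d≤b)))))

#U-++ : ∀ x y → #U (x ++ y) ≡ #U x + #U y
#U-++ x y = trans (cong length (filter-++ (U ≟ˢ_) x y)) (length-++ (filter (U ≟ˢ_) x))

#D-++ : ∀ x y → #D (x ++ y) ≡ #D x + #D y
#D-++ x y = trans (cong length (filter-++ (D ≟ˢ_) x y)) (length-++ (filter (D ≟ˢ_) x))

#U+#D≡length : ∀ w → #U w + #D w ≡ length w
#U+#D≡length []      = refl
#U+#D≡length (U ∷ w) = cong suc (#U+#D≡length w)
#U+#D≡length (D ∷ w) = trans (+-suc (#U w) (#D w)) (cong suc (#U+#D≡length w))

-- Valleys

-- ValleyAt w c d: the D of a valley DU of w is preceded by c U's and d D's, so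
-- that the valley has position (c + d + 1 , c − d − 1).
data ValleyAt : Word → ℕ → ℕ → Set where
  here   : ∀ {w} → ValleyAt (D ∷ U ∷ w) 0 0
  thereU : ∀ {w c d} → ValleyAt w c d → ValleyAt (U ∷ w) (suc c) d
  thereD : ∀ {w c d} → ValleyAt w c d → ValleyAt (D ∷ w) c (suc d)

-- Inclusion of faces in the coordinates of `ValleyAt`, which suit induction on words; equivalent to
-- `V w ⊆ V w′` by `⊑⇒⊆` and `⊆⇒⊑`.
_⊑_ : Word → Word → Set
w ⊑ w′ = ∀ {c d} → ValleyAt w c d → ValleyAt w′ c d

IsValley⇒ValleyAt : ∀ w i → IsValley w (suc i) → ∃₂ λ c d → c + d ≡ i × ValleyAt w c d
IsValley⇒ValleyAt []          zero    (() , _)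
IsValley⇒ValleyAt []          (suc i) (() , _)
IsValley⇒ValleyAt (U ∷ w)     zero    (() , _)
IsValley⇒ValleyAt (D ∷ [])    zero    (_ , ())
IsValley⇒ValleyAt (D ∷ D ∷ w) zero    (_ , ())
IsValley⇒ValleyAt (D ∷ U ∷ w) zero    _ = 0 , 0 , refl , here
IsValley⇒ValleyAt (U ∷ w) (suc i) v with c , d , eq , at ← IsValley⇒ValleyAt w i v =
  suc c , d , cong suc eq , thereU at
IsValley⇒ValleyAt (D ∷ w) (suc i) v with c , d , eq , at ← IsValley⇒ValleyAt w i v =
  c , suc d , trans (+-suc c d) (cong suc eq) , thereD at

ValleyAt⇒IsValley : ∀ {w c d} → ValleyAt w c d → IsValley w (suc (c + d))
ValleyAt⇒IsValley here        = refl , refl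
ValleyAt⇒IsValley (thereU at) = ValleyAt⇒IsValley at
ValleyAt⇒IsValley {c = c} {suc d} (thereD at) rewrite +-suc c d = ValleyAt⇒IsValley at

ValleyAt-#U : ∀ {w c d} → ValleyAt w c d → #U (take (suc (c + d)) w) ≡ c
ValleyAt-#U here        = refl
ValleyAt-#U (thereU at) = cong suc (ValleyAt-#U at)
ValleyAt-#U {c = c} {suc d} (thereD at) rewrite +-suc c d = ValleyAt-#U at

ValleyAt-#D : ∀ {w c d} → ValleyAt w c d → #D (take (suc (c + d)) w) ≡ suc d
ValleyAt-#D here        = refl
ValleyAt-#D (thereU at) = ValleyAt-#D at
ValleyAt-#D {c = c} {suc d} (thereD at) rewrite +-suc c d = cong suc (ValleyAt-#D at)

ValleyAt-<length : ∀ {w c d} → ValleyAt w c d → suc (c + d) < length w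
ValleyAt-<length here        = s≤s (s≤s z≤n)
ValleyAt-<length (thereU at) = s≤s (ValleyAt-<length at)
ValleyAt-<length {c = c} {suc d} (thereD at) rewrite +-suc c d = s≤s (ValleyAt-<length at)

position-ValleyAt : ∀ {w c d} → ValleyAt w c d →
  position w (suc (c + d)) ≡ (suc (c + d) , c ⊖ suc d)
position-ValleyAt at = cong₂ (λ a b → _ , a ⊖ b) (ValleyAt-#U at) (ValleyAt-#D at)

ValleyAt⇒∈V : ∀ {w c d} → ValleyAt w c d → (suc (c + d) , c ⊖ suc d) ∈ elements (V w)
ValleyAt⇒∈V {w} at = subst (_∈ elements (V w)) (position-ValleyAt at)
  (∈-map⁺ (position w)
    (∈-filter⁺ (isValley? w) (∈-upTo⁺ (ValleyAt-<length at)) (ValleyAt⇒IsValley at)))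

∈V⇒ValleyAt : ∀ {w p} → p ∈ elements (V w) →
  ∃₂ λ c d → ValleyAt w c d × p ≡ (suc (c + d) , c ⊖ suc d)
∈V⇒ValleyAt {w} p∈ with ∈-map⁻ (position w) p∈
... | i , i∈ , eq with ∈-filter⁻ (isValley? w) {xs = upTo (length w)} i∈
...   | _ , valley with i | valley
...     | zero  | () , _
...     | suc i | valley with c , d , refl , at ← IsValley⇒ValleyAt w i valley =
  c , d , at , trans eq (position-ValleyAt at)

⊑⇒⊆ : ∀ {w w′} → w ⊑ w′ → V w ⊆ V w′
⊑⇒⊆ {w} w⊑w′ p∈ with c , d , at , refl ← ∈V⇒ValleyAt {w} p∈ = ValleyAt⇒∈V (w⊑w′ at)

⊆⇒⊑ : ∀ {w w′} → V w ⊆ V w′ → w ⊑ w′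
⊆⇒⊑ {w} {w′} w⊆w′ {c} {d} at with c′ , d′ , at′ , eq ← ∈V⇒ValleyAt {w′} (w⊆w′ (ValleyAt⇒∈V at))
  with pos≡ , height≡ ← ,-injective eq
  with refl , refl ← ⊖-+-injective {c} {suc d} {c′} {suc d′}
         (trans (+-suc c d) (trans pos≡ (sym (+-suc c′ d′)))) height≡ = at′

-- Recovering a word from its valleys.

first-valley : ∀ w {k} → #U w ≡ suc k → ∃ λ d → ValleyAt (D ∷ w) 0 d
first-valley []      ()
first-valley (U ∷ w) _  = 0 , here
first-valley (D ∷ w) eq with d , at ← first-valley w eq = suc d , thereD at

⊑-tailU : ∀ {w w′} → (U ∷ w) ⊑ (U ∷ w′) → w ⊑ w′
⊑-tailU le at with thereU at′ ← le (thereU at) = at′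

⊑-tailD : ∀ {w w′} → (D ∷ w) ⊑ (D ∷ w′) → w ⊑ w′
⊑-tailD le at with thereD at′ ← le (thereD at) = at′

-- A word starting with D that still has a U to come has a valley preceded by no U, whereas every
-- valley of a word starting with U is preceded by that U.
U∷⋢D∷ : ∀ {w w′ k} → (D ∷ w′) ⊑ (U ∷ w) → #U w′ ≢ suc k
U∷⋢D∷ {w′ = w′} le eq with d , at ← first-valley w′ eq with () ← le at

⊑-antisym : ∀ w w′ → #U w ≡ #U w′ → #D w ≡ #D w′ → w ⊑ w′ → w′ ⊑ w → w ≡ w′
⊑-antisym []      []       _  _  _ _ = refl
⊑-antisym []      (U ∷ w′) () _  _ _
⊑-antisym []      (D ∷ w′) _  () _ _
⊑-antisym (U ∷ w) []       () _  _ _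
⊑-antisym (D ∷ w) []       _  () _ _
⊑-antisym (U ∷ w) (U ∷ w′) eu ed le ge =
  cong (U ∷_) (⊑-antisym w w′ (suc-injective eu) ed (⊑-tailU le) (⊑-tailU ge))
⊑-antisym (D ∷ w) (D ∷ w′) eu ed le ge =
  cong (D ∷_) (⊑-antisym w w′ eu (suc-injective ed) (⊑-tailD le) (⊑-tailD ge))
-- By `eu`, the word starting with D must still contain a U, so its next valley exists.
⊑-antisym (U ∷ w) (D ∷ w′) eu _ _ ge = ⊥-elim (U∷⋢D∷ ge (sym eu))
⊑-antisym (D ∷ w) (U ∷ w′) eu _ le _ = ⊥-elim (U∷⋢D∷ le eu)

ValleyAt-++⁺ : ∀ x {y c d} → ValleyAt y c d → ValleyAt (x ++ y) (#U x + c) (#D x + d)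
ValleyAt-++⁺ []      at = at
ValleyAt-++⁺ (U ∷ x) at = thereU (ValleyAt-++⁺ x at)
ValleyAt-++⁺ (D ∷ x) at = thereD (ValleyAt-++⁺ x at)

ValleyAt-++⁻ : ∀ x {y c d} → ValleyAt (x ++ y) (#U x + c) (#D x + d) → ValleyAt y c d
ValleyAt-++⁻ []      at          = at
ValleyAt-++⁻ (U ∷ x) (thereU at) = ValleyAt-++⁻ x at
ValleyAt-++⁻ (D ∷ x) (thereD at) = ValleyAt-++⁻ x at

ValleyAt-split : ∀ {w c d} → ValleyAt w c d →
  ∃₂ λ x y → w ≡ x ++ D ∷ U ∷ y × #U x ≡ c × #D x ≡ d
ValleyAt-split (here {w})  = [] , w , refl , refl , refl
ValleyAt-split (thereU at) with x , y , refl , eu , ed ← ValleyAt-split at =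
  U ∷ x , y , refl , cong suc eu , ed
ValleyAt-split (thereD at) with x , y , refl , eu , ed ← ValleyAt-split at =
  D ∷ x , y , refl , eu , cong suc ed

-- 1-based, like valleys.
junction : Step → Word → List ℕ
junction D (U ∷ _) = 1 ∷ []
junction _ _       = []

-- Turns the index search behind `valleys` into a recursion on words: a new first letter shifts
-- every index by one and can create a valley only at index 1.
valleys-∷ : ∀ s w → valleys (s ∷ w) ≡ junction s w ++ map suc (valleys w)
valleys-∷ s w = begin
  filter (isValley? (s ∷ w)) (applyUpTo suc (length w))
    ≡⟨ cong (filter (isValley? (s ∷ w))) (sym (map-upTo suc (length w))) ⟩
  filter (isValley? (s ∷ w)) (map suc (upTo (length w)))
    ≡⟨ filter-map (isValley? (s ∷ w)) suc (upTo (length w)) ⟩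
  map suc (filter (isValley? (s ∷ w) ∘ suc) (upTo (length w)))
    ≡⟨ after-first s w ⟩
  junction s w ++ map suc (valleys w) ∎
  where
  open ≡-Reasoning
  -- From index 1 on, deleting the first letter preserves the valley test definitionally. Index 0 is
  -- split off because `‼` returns `nothing` there.
  tails-agree : ∀ s t w m →
    filter (isValley? (s ∷ t ∷ w) ∘ suc) (applyUpTo suc m) ≡ filter (isValley? (t ∷ w)) (applyUpTo suc m)
  tails-agree s t w m rewrite sym (map-upTo suc m) =
    trans (filter-map (isValley? (s ∷ t ∷ w) ∘ suc) suc (upTo m))
          (sym (filter-map (isValley? (t ∷ w)) suc (upTo m)))

  after-first : ∀ s w → map suc (filter (isValley? (s ∷ w) ∘ suc) (upTo (length w)))
                        ≡ junction s w ++ map suc (valleys w)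
  after-first U []      = refl
  after-first D []      = refl
  after-first U (U ∷ w) = cong (map suc) (tails-agree U U w (length w))
  after-first U (D ∷ w) = cong (map suc) (tails-agree U D w (length w))
  after-first D (U ∷ w) = cong (λ is → 1 ∷ map suc is) (tails-agree D U w (length w))
  after-first D (D ∷ w) = cong (map suc) (tails-agree D D w (length w))

-- Counting valleys.

#valleys : Word → ℕ
#valleys []              = 0
#valleys (U ∷ w)         = #valleys w
#valleys (D ∷ [])        = 0
#valleys (D ∷ U ∷ w)     = suc (#valleys w)
#valleys (D ∷ w@(D ∷ _)) = #valleys w

length-valleys : ∀ w → length (valleys w) ≡ #valleys w
length-valleys []          = refl
length-valleys (U ∷ w)     = trans (cong length (valleys-∷ U w))
  (trans (length-map suc (valleys w)) (length-valleys w))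
length-valleys (D ∷ [])    = refl
length-valleys (D ∷ U ∷ w) = trans (cong length (valleys-∷ D (U ∷ w)))
  (cong suc (trans (length-map suc (valleys (U ∷ w))) (length-valleys (U ∷ w))))
length-valleys (D ∷ D ∷ w) = trans (cong length (valleys-∷ D (D ∷ w)))
  (trans (length-map suc (valleys (D ∷ w))) (length-valleys (D ∷ w)))

card-V : ∀ w → card (V w) ≡ #valleys w
card-V w = trans (length-map (position w) (valleys w)) (length-valleys w)

#valleys-D∷ : ∀ w → #valleys (D ∷ w) ≤ suc (#valleys w)
#valleys-D∷ []      = z≤n
#valleys-D∷ (U ∷ w) = ≤-refl
#valleys-D∷ (D ∷ w) = n≤1+n _

#valleys≤#U : ∀ w → #valleys w ≤ #U w
#valleys≤#U []          = z≤n
#valleys≤#U (U ∷ w)     = m≤n⇒m≤1+n (#valleys≤#U w)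
#valleys≤#U (D ∷ [])    = z≤n
#valleys≤#U (D ∷ U ∷ w) = s≤s (#valleys≤#U w)
#valleys≤#U (D ∷ D ∷ w) = #valleys≤#U (D ∷ w)

data EndsD : Word → Set where
  [D] : EndsD (D ∷ [])
  _∷_ : ∀ s {w} → EndsD w → EndsD (s ∷ w)

EndsD-++⁻ : ∀ x {s y} → EndsD (x ++ s ∷ y) → EndsD (s ∷ y)
EndsD-++⁻ []      end       = end
EndsD-++⁻ (_ ∷ []) (_ ∷ end) = end
EndsD-++⁻ (_ ∷ x@(_ ∷ _)) (_ ∷ end) = EndsD-++⁻ x end

-- Distinct valleys use distinct D's, and the final D starts no valley; hence the strictness.
#valleys<#D : ∀ {w} → EndsD w → #valleys w < #D w
#valleys<#D [D]               = s≤s z≤n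
#valleys<#D (U ∷ end)         = #valleys<#D end
#valleys<#D {D ∷ w} (D ∷ end) = s≤s (≤-trans (#valleys-D∷ w) (#valleys<#D end))

-- Valleys before the displayed DU are charged to their U's in `x`, the displayed one to `suc`,
-- later ones to `y`. The companion `#valleys-split-#D` charges to D's instead.
#valleys-split-#U : ∀ x y → #valleys (x ++ D ∷ U ∷ y) ≤ suc (#U x) + #valleys y
#valleys-split-#U []          y = ≤-refl
#valleys-split-#U (U ∷ x)     y = m≤n⇒m≤1+n (#valleys-split-#U x y)
#valleys-split-#U (D ∷ [])    y = ≤-refl
#valleys-split-#U (D ∷ U ∷ x) y = s≤s (#valleys-split-#U x y)
#valleys-split-#U (D ∷ D ∷ x) y = #valleys-split-#U (D ∷ x) y

#valleys-split-#D : ∀ x y → #valleys (x ++ D ∷ U ∷ y) ≤ suc (#D x) + #valleys y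
#valleys-split-#D []      y = ≤-refl
#valleys-split-#D (U ∷ x) y = #valleys-split-#D x y
#valleys-split-#D (D ∷ x) y = ≤-trans (#valleys-D∷ (x ++ D ∷ U ∷ y)) (s≤s (#valleys-split-#D x y))

-- Decomposition into mountains

-- slope u d = U^u D^(d+1)
slope : ℕ → ℕ → Word
slope zero    zero    = D ∷ []
slope zero    (suc d) = D ∷ slope zero d
slope (suc u) d       = U ∷ slope u d

-- The pair (u , d) stands for the portion U^(u+1) D^(d+1) between two consecutive
-- valleys.
range : List (ℕ × ℕ) → Word
range = concatMap λ (u , d) → U ∷ slope u d

-- teeth u d has u U's and d + 1 D's; U ∷ teeth u d crosses the portion (u , d)
-- with as many valleys as possible.
teeth : ℕ → ℕ → Word
teeth zero    d       = slope zero d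
teeth (suc u) zero    = U ∷ teeth u zero
teeth (suc u) (suc d) = D ∷ U ∷ teeth u d

sierra : List (ℕ × ℕ) → Word
sierra = concatMap λ (u , d) → U ∷ teeth u d

-- This is the sum in the definition of `μ`, before 1 is subtracted: min{u+1, d+1} = min{u, d} + 1.
minSum : List (ℕ × ℕ) → ℕ
minSum = sum ∘ map λ (u , d) → suc (u ⊓ d)

#U-slope : ∀ u d → #U (slope u d) ≡ u
#U-slope zero    zero    = refl
#U-slope zero    (suc d) = #U-slope zero d
#U-slope (suc u) d       = cong suc (#U-slope u d)

#D-slope : ∀ u d → #D (slope u d) ≡ suc d
#D-slope zero    zero    = refl
#D-slope zero    (suc d) = cong suc (#D-slope zero d)
#D-slope (suc u) d       = #D-slope u d

#U-teeth : ∀ u d → #U (teeth u d) ≡ u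
#U-teeth zero    d       = #U-slope zero d
#U-teeth (suc u) zero    = cong suc (#U-teeth u zero)
#U-teeth (suc u) (suc d) = cong suc (#U-teeth u d)

#D-teeth : ∀ u d → #D (teeth u d) ≡ suc d
#D-teeth zero    d       = #D-slope zero d
#D-teeth (suc u) zero    = #D-teeth u zero
#D-teeth (suc u) (suc d) = cong suc (#D-teeth u d)

#U-sierra : ∀ bs → #U (sierra bs) ≡ #U (range bs)
#U-sierra []             = refl
#U-sierra ((u , d) ∷ bs) = cong suc (begin
  #U (teeth u d ++ sierra bs)      ≡⟨ #U-++ (teeth u d) (sierra bs) ⟩
  #U (teeth u d) + #U (sierra bs)  ≡⟨ cong₂ _+_ (trans (#U-teeth u d) (sym (#U-slope u d))) (#U-sierra bs) ⟩
  #U (slope u d) + #U (range bs)   ≡⟨ #U-++ (slope u d) (range bs) ⟨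
  #U (slope u d ++ range bs)       ∎)
  where open ≡-Reasoning

slope-junction : ∀ u d {z} → ValleyAt (slope u d ++ U ∷ z) u d
slope-junction zero    zero    = here
slope-junction zero    (suc d) = thereD (slope-junction zero d)
slope-junction (suc u) d       = thereU (slope-junction u d)

teeth-junction : ∀ u d {z} → ValleyAt (teeth u d ++ U ∷ z) u d
teeth-junction zero    d       = slope-junction zero d
teeth-junction (suc u) zero    = thereU (teeth-junction u zero)
teeth-junction (suc u) (suc d) = thereD (thereU (teeth-junction u d))

-- Since U^u D^(d+1) has no valley inside, a valley either straddles the junction with `y` or lies
-- in `y`.
ValleyAt-slope⁻ : ∀ u d y {c e} → ValleyAt (slope u d ++ y) c e →
  ((∃ λ z → y ≡ U ∷ z) × c ≡ u × e ≡ d) ⊎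
  (∃₂ λ c′ e′ → c ≡ u + c′ × e ≡ suc d + e′ × ValleyAt y c′ e′)
ValleyAt-slope⁻ zero    zero    _ here        = inj₁ ((_ , refl) , refl , refl)
ValleyAt-slope⁻ zero    zero    _ (thereD at) = inj₂ (_ , _ , refl , refl , at)
ValleyAt-slope⁻ zero    (suc zero)    y (thereD at) with ValleyAt-slope⁻ zero zero y at
... | inj₁ (U∷ , eu , ed)          = inj₁ (U∷ , eu , cong suc ed)
... | inj₂ (_ , _ , eu , ed , at′) = inj₂ (_ , _ , eu , cong suc ed , at′)
ValleyAt-slope⁻ zero    (suc (suc d)) y (thereD at) with ValleyAt-slope⁻ zero (suc d) y at
... | inj₁ (U∷ , eu , ed)          = inj₁ (U∷ , eu , cong suc ed)
... | inj₂ (_ , _ , eu , ed , at′) = inj₂ (_ , _ , eu , cong suc ed , at′)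
ValleyAt-slope⁻ (suc u) d       y (thereU at) with ValleyAt-slope⁻ u d y at
... | inj₁ (U∷ , eu , ed)          = inj₁ (U∷ , cong suc eu , ed)
... | inj₂ (_ , _ , eu , ed , at′) = inj₂ (_ , _ , cong suc eu , ed , at′)

-- `teeth u d` has the letter counts of `slope u d` and also ends in D, so both words meet the next
-- mountain at the same valley.
range⊑sierra : ∀ bs → range bs ⊑ sierra bs
range⊑sierra ((u , d) ∷ bs) (thereU at) with ValleyAt-slope⁻ u d (range bs) at
range⊑sierra ((u , d) ∷ _ ∷ _) (thereU _) | inj₁ (_ , refl , refl) = thereU (teeth-junction u d)
range⊑sierra ((u , d) ∷ bs) (thereU _) | inj₂ (c , e , refl , refl , at) =
  thereU (subst₂ (λ a b → ValleyAt (teeth u d ++ sierra bs) (a + c) (b + e))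
           (#U-teeth u d) (#D-teeth u d) (ValleyAt-++⁺ (teeth u d) (range⊑sierra bs at)))

#valleys-slope : ∀ d z → #valleys (slope zero d ++ U ∷ z) ≡ suc (#valleys z)
#valleys-slope zero          z = refl
#valleys-slope (suc zero)    z = refl
#valleys-slope (suc (suc d)) z = #valleys-slope (suc d) z

#valleys-teeth-++ : ∀ u d z → #valleys (teeth u d ++ U ∷ z) ≡ suc (u ⊓ d) + #valleys z
#valleys-teeth-++ zero    d       z = #valleys-slope d z
#valleys-teeth-++ (suc u) zero    z =
  trans (#valleys-teeth-++ u zero z) (cong (λ m → suc m + #valleys z) (⊓-zeroʳ u))
#valleys-teeth-++ (suc u) (suc d) z = cong suc (#valleys-teeth-++ u d z)

#valleys-slope-[] : ∀ d → #valleys (slope zero d ++ []) ≡ 0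
#valleys-slope-[] zero          = refl
#valleys-slope-[] (suc zero)    = refl
#valleys-slope-[] (suc (suc d)) = #valleys-slope-[] (suc d)

#valleys-teeth : ∀ u d → #valleys (teeth u d ++ []) ≡ u ⊓ d
#valleys-teeth zero    d       = #valleys-slope-[] d
#valleys-teeth (suc u) zero    = trans (#valleys-teeth u zero) (⊓-zeroʳ u)
#valleys-teeth (suc u) (suc d) = cong suc (#valleys-teeth u d)

-- Each mountain yields min{u, d} inner valleys and one at its end, except that no valley ends the
-- last mountain; the outer `suc` makes up for it.
#valleys-sierra : ∀ b bs → suc (#valleys (sierra (b ∷ bs))) ≡ minSum (b ∷ bs)
#valleys-sierra (u , d) [] = cong suc (trans (#valleys-teeth u d) (sym (+-identityʳ (u ⊓ d))))
#valleys-sierra (u , d) bs@(b′@(u′ , d′) ∷ bs′) = begin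
  suc (#valleys (teeth u d ++ sierra bs))      ≡⟨ cong suc (#valleys-teeth-++ u d (teeth u′ d′ ++ sierra bs′)) ⟩
  suc (suc (u ⊓ d) + #valleys (sierra bs))     ≡⟨ +-suc (suc (u ⊓ d)) _ ⟨
  suc (u ⊓ d) + suc (#valleys (sierra bs))     ≡⟨ cong (suc (u ⊓ d) +_) (#valleys-sierra b′ bs′) ⟩
  suc (u ⊓ d) + minSum bs                      ∎
  where open ≡-Reasoning

-- Induction on the mountains of the range. The valley ending the first one also lies on `U ∷ x` and
-- cuts it there; the remainder has the letter counts of the remaining range and passes through its
-- valleys. For a single mountain, the leading U belongs to no valley and the final D to none,
-- giving both bounds in the minimum.
#valleys<minSum : ∀ b bs x → EndsD (U ∷ x) → #U (U ∷ x) ≡ #U (range (b ∷ bs)) →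
  #D (U ∷ x) ≡ #D (range (b ∷ bs)) → range (b ∷ bs) ⊑ (U ∷ x) →
  #valleys (U ∷ x) < minSum (b ∷ bs)
#valleys<minSum (u , d) [] x end eu ed _
  rewrite #U-++ (slope u d) [] | #D-++ (slope u d) [] | #U-slope u d | #D-slope u d
  | +-identityʳ u | +-identityʳ d | +-identityʳ (u ⊓ d) =
  ⊓-glb (s≤s (≤-trans (#valleys≤#U x) (≤-reflexive (suc-injective eu))))
        (≤-trans (#valleys<#D end) (≤-reflexive ed))
#valleys<minSum (u , d) bs@(b′@(u′ , d′) ∷ bs′) x end eu ed le with le (thereU (slope-junction u d))
... | thereU at with p , y , refl , refl , refl ← ValleyAt-split at = begin
  suc (#valleys (p ++ D ∷ U ∷ y))                ≤⟨ s≤s split ⟩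
  suc (suc (u ⊓ d) + #valleys y)                 ≡⟨ +-suc (suc (u ⊓ d)) _ ⟨
  suc (u ⊓ d) + suc (#valleys (U ∷ y))           ≤⟨ +-monoʳ-≤ (suc (u ⊓ d))
                                                    (#valleys<minSum b′ bs′ y end′ eu′ ed′ le′) ⟩
  suc (u ⊓ d) + minSum bs                        ∎
  where
  open ≤-Reasoning

  split : #valleys (p ++ D ∷ U ∷ y) ≤ suc (u ⊓ d) + #valleys y
  -- The piece `p` has u U's and d D's; valleys are charged to whichever letter is rarer.
  split with ⊓-sel u d
  ... | inj₁ eq rewrite eq = #valleys-split-#U p y
  ... | inj₂ eq rewrite eq = #valleys-split-#D p y

  end′ : EndsD (U ∷ y)
  end′ with _ ∷ end″ ← EndsD-++⁻ (U ∷ p) end = end″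

  eu′ : #U (U ∷ y) ≡ #U (range bs)
  eu′ = +-cancelˡ-≡ u _ _ (trans (sym (#U-++ p (D ∷ U ∷ y))) (trans (suc-injective eu)
          (trans (#U-++ (slope u d) (range bs)) (cong (_+ #U (range bs)) (#U-slope u d)))))

  ed′ : #D (U ∷ y) ≡ #D (range bs)
  ed′ = +-cancelˡ-≡ (suc d) _ _ (trans (sym (+-suc d _)) (trans (sym (#D-++ p (D ∷ U ∷ y))) (trans ed
          (trans (#D-++ (slope u d) (range bs)) (cong (_+ #D (range bs)) (#D-slope u d))))))

  le′ : range bs ⊑ (U ∷ y)
  le′ {c} {e} v with le (thereU (subst₂ (λ a b → ValleyAt (slope u d ++ range bs) (a + c) (b + e))
                                   (#U-slope u d) (#D-slope u d) (ValleyAt-++⁺ (slope u d) v)))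
  -- `slope u d` contains one D more than `p`, namely the D of the cutting valley; hence `suc e`,
  -- with that D removed by `thereD`.
  ... | thereU v′ with v″ ← ValleyAt-++⁻ p {c = c} {d = suc e}
                               (subst (ValleyAt _ _) (sym (+-suc d e)) v′)
                  with thereD v‴ ← v″ = v‴

-- μ of a range

-- Restates the local function of `μ`, so that `μ w` is definitionally `sum (peaks w) ∸ 1`.
peak : Word → ℕ → ℕ → ℕ
peak w a b = #U (portion w a b) ⊓ #D (portion w a b)

peaks : Word → List ℕ
peaks w = zipWith (peak w) (0 ∷ valleys w) (valleys w ∷ʳ length w)

drop-length-+ : ∀ {A : Set} (x y : List A) a → drop (length x + a) (x ++ y) ≡ drop a y
drop-length-+ []      y a = refl
drop-length-+ (_ ∷ x) y a = drop-length-+ x y a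

take-length-++ : ∀ {A : Set} (x y : List A) → take (length x) (x ++ y) ≡ x
take-length-++ []      y = refl
take-length-++ (s ∷ x) y = cong (s ∷_) (take-length-++ x y)

peak-+ : ∀ x y a b → peak (x ++ y) (length x + a) (length x + b) ≡ peak y a b
peak-+ x y a b = cong (λ p → #U p ⊓ #D p)
  (cong₂ take ([m+n]∸[m+o]≡n∸o (length x) b a) (drop-length-+ x y a))

-- By hypothesis the first valley is the end of `x`, which is the starting point 0 of `y` shifted by
-- `length x`; the other zipped pairs are those of `y` under the same shift.
peaks-++ : ∀ x y → valleys (x ++ y) ≡ map (length x +_) (0 ∷ valleys y) →
  peaks (x ++ y) ≡ (#U x ⊓ #D x) ∷ peaks y
peaks-++ x y eq rewrite eq | length-++ x {y} | sym (map-++ (length x +_) (valleys y) (length y ∷ [])) =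
  cong₂ _∷_
    (cong (λ p → #U p ⊓ #D p)
      (trans (cong (λ k → take k (x ++ y)) (+-identityʳ (length x))) (take-length-++ x y)))
    (trans (zipWith-map (peak (x ++ y)) (length x +_) (length x +_) (0 ∷ valleys y) (valleys y ∷ʳ length y))
           (zipWith-cong (peak-+ x y) (0 ∷ valleys y) (valleys y ∷ʳ length y)))

valleys-slope-++ : ∀ u d z →
  valleys (slope u d ++ U ∷ z) ≡ map (length (slope u d) +_) (0 ∷ valleys (U ∷ z))
valleys-slope-++ zero    zero    z = valleys-∷ D (U ∷ z)
valleys-slope-++ zero    (suc zero) z =
  trans (valleys-∷ D (D ∷ U ∷ z)) (trans (cong (map suc) (valleys-slope-++ zero zero z)) (sym (map-∘ _)))
valleys-slope-++ zero    (suc (suc d)) z =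
  trans (valleys-∷ D (slope zero (suc d) ++ U ∷ z))
        (trans (cong (map suc) (valleys-slope-++ zero (suc d) z)) (sym (map-∘ _)))
valleys-slope-++ (suc u) d       z =
  trans (valleys-∷ U (slope u d ++ U ∷ z))
        (trans (cong (map suc) (valleys-slope-++ u d z)) (sym (map-∘ _)))

valleys-slope : ∀ u d → valleys (slope u d) ≡ []
valleys-slope zero    zero          = refl
valleys-slope zero    (suc zero)    = refl
valleys-slope zero    (suc (suc d)) =
  trans (valleys-∷ D (slope zero (suc d))) (cong (map suc) (valleys-slope zero (suc d)))
valleys-slope (suc u) d             =
  trans (valleys-∷ U (slope u d)) (cong (map suc) (valleys-slope u d))

peaks-range : ∀ b bs → peaks (range (b ∷ bs)) ≡ map (λ (u , d) → suc (u ⊓ d)) (b ∷ bs)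
peaks-range (u , d) [] rewrite ++-identityʳ (slope u d) | valleys-slope (suc u) d
  | take-all (length (slope u d)) (slope u d) ≤-refl | #U-slope u d | #D-slope u d = refl
peaks-range (u , d) (b′@(u′ , d′) ∷ bs) =
  trans (peaks-++ (slope (suc u) d) (range (b′ ∷ bs)) (valleys-slope-++ (suc u) d (slope u′ d′ ++ range bs)))
        (cong₂ _∷_ (cong₂ _⊓_ (#U-slope (suc u) d) (#D-slope (suc u) d)) (peaks-range b′ bs))

μ-range : ∀ b bs → μ (range (b ∷ bs)) ≡ minSum (b ∷ bs) ∸ 1
μ-range b bs = cong (λ ps → sum ps ∸ 1) (peaks-range b bs)

-- Dyck paths

-- The index is the starting height; the path ends at height 0.
data Path : ℕ → Word → Set where
  end  : Path 0 []
  up   : ∀ {h w} → Path (suc h) w → Path h (U ∷ w)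
  down : ∀ {h w} → Path h w → Path (suc h) (D ∷ w)

Nonneg : ℕ → Word → Set
Nonneg h = λ p → #D p ≤ h + #U p

mkPath : ∀ h w → #D w ≡ h + #U w → All (Nonneg h) (inits w) → Path h w
mkPath zero    []      _  _ = end
mkPath (suc h) []      () _
mkPath h       (U ∷ w) eq (_ ∷ nonneg) = up (mkPath (suc h) w (trans eq (+-suc h _))
  (All.map (λ {p} le → subst (#D p ≤_) (+-suc h _) le) (All.map⁻ nonneg)))
mkPath zero    (D ∷ w) _  (_ ∷ () ∷ _)
mkPath (suc h) (D ∷ w) eq (_ ∷ nonneg) =
  down (mkPath h w (suc-injective eq) (All.map (λ where (s≤s le) → le) (All.map⁻ nonneg)))

Path-balance : ∀ {h w} → Path h w → #D w ≡ h + #U w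
Path-balance end          = refl
Path-balance {h} (up π)   = trans (Path-balance π) (sym (+-suc h _))
Path-balance (down π)     = cong suc (Path-balance π)

Path-nonneg : ∀ {h w} → Path h w → All (Nonneg h) (inits w)
Path-nonneg end        = z≤n ∷ []
Path-nonneg {h} (up π) =
  z≤n ∷ All.map⁺ (All.map (λ {p} le → subst (#D p ≤_) (sym (+-suc h _)) le) (Path-nonneg π))
Path-nonneg (down π)   = z≤n ∷ All.map⁺ (All.map s≤s (Path-nonneg π))

Path-EndsD : ∀ {h s w} → Path h (s ∷ w) → EndsD (s ∷ w)
Path-EndsD (up π@(up _))     = U ∷ Path-EndsD π
Path-EndsD (up π@(down _))   = U ∷ Path-EndsD π
Path-EndsD (down end)        = [D]
Path-EndsD (down π@(up _))   = D ∷ Path-EndsD π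
Path-EndsD (down π@(down _)) = D ∷ Path-EndsD π

replicate-D∷ : ∀ k y → replicate (suc k) D ++ y ≡ slope zero k ++ y
replicate-D∷ zero    y = refl
replicate-D∷ (suc k) y = cong (D ∷_) (replicate-D∷ k y)

-- Built from the right, with the leading D's kept aside. A new U either closes these D's into a
-- mountain or, if there are none, lengthens the ascent of the first mountain.
Path-decompose : ∀ {h w} → Path h w → ∃₂ λ k bs → w ≡ replicate k D ++ range bs
Path-decompose end = 0 , [] , refl
Path-decompose (down π) with k , bs , refl ← Path-decompose π = suc k , bs , refl
Path-decompose (up π) with Path-decompose π
... | suc k , bs , refl           = 0 , (0 , k) ∷ bs , cong (U ∷_) (replicate-D∷ k (range bs))
... | zero , (u , d) ∷ bs , refl  = 0 , (suc u , d) ∷ bs , refl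
... | zero , [] , refl with () ← π

Path-slope⁻ : ∀ u d {h y} → Path h (slope u d ++ y) → ∃ λ k → k + suc d ≡ h + u × Path k y
Path-slope⁻ zero    zero    {suc h} (down π) = h , trans (+-comm h 1) (sym (+-identityʳ (suc h))) , π
Path-slope⁻ zero    (suc d) (down π) with k , eq , π′ ← Path-slope⁻ zero d π =
  k , trans (+-suc k _) (cong suc eq) , π′
Path-slope⁻ (suc u) d {h} (up π) with k , eq , π′ ← Path-slope⁻ u d π =
  k , trans eq (sym (+-suc h u)) , π′

Path-slope⁺ : ∀ d {h k y} → k + suc d ≡ h → Path k y → Path h (slope zero d ++ y)
Path-slope⁺ zero    {k = k} refl π rewrite +-comm k 1 = down π
Path-slope⁺ (suc d) {k = k} refl π rewrite +-suc k (suc d) = down (Path-slope⁺ d refl π)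

-- The height `suc h`, reached after the mountain's leading U, leaves room for the D of each DU,
-- which then returns to the same height.
Path-teeth : ∀ u d {h k y} → k + d ≡ h + u → Path k y → Path (suc h) (teeth u d ++ y)
Path-teeth zero    d       {h} {k} eq π =
  Path-slope⁺ d (trans (+-suc k d) (cong suc (trans eq (+-identityʳ h)))) π
Path-teeth (suc u) zero    {h}     eq π = up (Path-teeth u zero (trans eq (+-suc h u)) π)
Path-teeth (suc u) (suc d) {h} {k} eq π = down (up (Path-teeth u d
  (suc-injective (trans (sym (+-suc k d)) (trans eq (+-suc h u)))) π))

Path-sierra : ∀ bs {h} → Path h (range bs) → Path h (sierra bs)
Path-sierra []             π      = π
Path-sierra ((u , d) ∷ bs) (up π) with k , eq , π′ ← Path-slope⁻ u d π =
  up (Path-teeth u d (suc-injective (trans (sym (+-suc k d)) eq)) (Path-sierra bs π′))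

IsDyck⇒Path : ∀ {n w} → IsDyck n w → Path 0 w
IsDyck⇒Path {w = w} (_ , #U≡#D , nonneg) = mkPath 0 w (sym #U≡#D) nonneg

Path⇒IsDyck : ∀ {n w} → Path 0 w → #U w ≡ n → IsDyck n w
Path⇒IsDyck {w = w} π refl =
  trans (sym (#U+#D≡length w)) (cong (#U w +_) (trans (Path-balance π) (sym (+-identityʳ _))))
  , sym (Path-balance π) , Path-nonneg π

IsDyck-#U : ∀ {n w} → IsDyck n w → #U w ≡ n
IsDyck-#U {n} {w} (len , #U≡#D , _) = *-cancelˡ-≡ _ _ 2
  (trans (cong (#U w +_) (trans (+-identityʳ _) #U≡#D)) (trans (#U+#D≡length w) len))

IsDyck-#D : ∀ {n w} → IsDyck n w → #D w ≡ n
IsDyck-#D {n} dyck@(_ , #U≡#D , _) = trans (sym #U≡#D) (IsDyck-#U {n} dyck)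

IsDyck-range : ∀ {n w} → 1 ≤ n → IsDyck n w → ∃₂ λ b bs → w ≡ range (b ∷ bs)
IsDyck-range {n} 1≤n dw with Path-decompose (IsDyck⇒Path {n} dw)
... | zero  , b ∷ bs , eq   = b , bs , eq
... | zero  , []     , refl = contradiction (subst (1 ≤_) (sym (IsDyck-#U {n} dw)) 1≤n) λ ()
... | suc _ , _      , refl with () ← IsDyck⇒Path {n} dw

-- Faces of the Dyck complex and their degrees.

V-injective : ∀ {n w w′} → IsDyck n w → IsDyck n w′ → V w ≐ V w′ → w ≡ w′
V-injective {n} {w} {w′} dw dw′ (le , ge) = ⊑-antisym w w′
  (trans (IsDyck-#U {n} dw) (sym (IsDyck-#U {n} dw′))) (trans (IsDyck-#D {n} dw) (sym (IsDyck-#D {n} dw′)))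
  (⊆⇒⊑ le) (⊆⇒⊑ ge)

-- Injectivity of `V` leaves `deduplicate` nothing to remove, so the faces are indexed by the Dyck
-- paths themselves.
ΔDyck≡map-V : ∀ n → ΔDyck n ≡ map V (Dyck n)
ΔDyck≡map-V n = deduplicate-AllPairs _≐?_ (distinct (Dyck-unique n) (All.tabulate (∈-Dyck⁻ {n})))
  where
  distinct : ∀ {ws} → AllPairs _≢_ ws → All (IsDyck n) ws → AllPairs (λ σ τ → ¬ σ ≐ τ) (map V ws)
  distinct []         []         = []
  distinct (≢w ∷ ≢ws) (dw ∷ dws) =
    All.map⁺ (All.zipWith (λ (≢w , dw′) → ≢w ∘ V-injective {n} dw dw′) (≢w , dws)) ∷ distinct ≢ws dws

#valleys≤μ : ∀ {n w w′} → 1 ≤ n → IsDyck n w → IsDyck n w′ → w ⊑ w′ → #valleys w′ ≤ μ w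
#valleys≤μ {n} 1≤n dw dw′ le
  with b , bs , refl ← IsDyck-range {n} 1≤n dw | _ , _ , refl ← IsDyck-range {n} 1≤n dw′ =
  ≤-trans (∸-monoˡ-≤ 1 (#valleys<minSum b bs _ (Path-EndsD (IsDyck⇒Path {n} dw′))
            (trans (IsDyck-#U {n} dw′) (sym (IsDyck-#U {n} dw)))
            (trans (IsDyck-#D {n} dw′) (sym (IsDyck-#D {n} dw))) le))
          (≤-reflexive (sym (μ-range b bs)))

∃-saturated : ∀ {n w} → 1 ≤ n → IsDyck n w → ∃ λ w′ → IsDyck n w′ × w ⊑ w′ × #valleys w′ ≡ μ w
∃-saturated {n} 1≤n dw with b , bs , refl ← IsDyck-range {n} 1≤n dw =
  sierra (b ∷ bs) ,
  Path⇒IsDyck (Path-sierra (b ∷ bs) (IsDyck⇒Path {n} dw))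
    (trans (#U-sierra (b ∷ bs)) (IsDyck-#U {n} dw)) ,
  range⊑sierra (b ∷ bs) ,
  trans (cong (_∸ 1) (#valleys-sierra b bs)) (sym (μ-range b bs))

deg-V : ∀ {n w} → 1 ≤ n → IsDyck n w → deg (map V (Dyck n)) (V w) ≡ μ w
deg-V {n} {w} 1≤n dw = ≤-antisym
  -- Here `z≤n` bounds the default value 0 of `max`.
  (max≤v⁺ z≤n (All.map⁺ (All.tabulate bounded)))
  (attained (∃-saturated {n} 1≤n dw))
  where
  cofaces : List (FinSet Position)
  cofaces = filter (V w ⊆?_) (map V (Dyck n))

  bounded : ∀ {τ} → τ ∈ cofaces → card τ ≤ μ w
  bounded τ∈ with τ∈V , w⊆τ ← ∈-filter⁻ (V w ⊆?_) {xs = map V (Dyck n)} τ∈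
             with w′ , w′∈ , refl ← ∈-map⁻ V τ∈V =
    subst (_≤ μ w) (sym (card-V w′)) (#valleys≤μ {n} 1≤n dw (∈-Dyck⁻ {n} w′∈) (⊆⇒⊑ w⊆τ))

  attained : (∃ λ w′ → IsDyck n w′ × w ⊑ w′ × #valleys w′ ≡ μ w) → μ w ≤ max 0 (map card cofaces)
  attained (w′ , dw′ , le , eq) = v≤max⁺ 0 _ (inj₂ (Any.map (≤-reflexive ∘ trans (sym (trans (card-V w′) eq)))
    (∈-map⁺ card (∈-filter⁺ (V w ⊆?_) (∈-map⁺ V (∈-Dyck⁺ {n} dw′)) (⊑⇒⊆ le)))))

theorem3p7 : (n : ℕ) → 1 ≤ n → (i j : ℕ) → j ≤ i → i ≤ n ∸ 1 →
    fTriangle (ΔDyck n) i j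
    ≡ length (filter (λ w → (card (V w) ≟ j) ×-dec (μ w ≟ i)) (Dyck n))
theorem3p7 n 1≤n i j _ _ rewrite ΔDyck≡map-V n = begin
  length (filter face? (map V (Dyck n)))            ≡⟨ cong length (filter-map face? V (Dyck n)) ⟩
  length (map V (filter (face? ∘ V) (Dyck n)))      ≡⟨ length-map V (filter (face? ∘ V) (Dyck n)) ⟩
  -- The cardinality condition is kept, while `deg-V` replaces the degree of each listed path's face
  -- by its `μ`.
  length (filter (face? ∘ V) (Dyck n))              ≡⟨ cong length (filter-cong-All
                                                       (λ w k → (card (V w) ≟ j) ×-dec (k ≟ i))
                                                       (All.tabulate (deg-V {n} 1≤n ∘ ∈-Dyck⁻ {n}))) ⟩
  length (filter (λ w → (card (V w) ≟ j) ×-dec (μ w ≟ i)) (Dyck n)) ∎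
  where
  open ≡-Reasoning
  face? = λ σ → (card σ ≟ j) ×-dec (deg (map V (Dyck n)) σ ≟ i)
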